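{- Let $t\ge1$ and $k\ge1$ be integers, and let $G$ be the $(n_1,\dots,n_{2t+1})$-blowup of the cycle $C_{2t+1}$. If $n_i\ge 2k$ for all $i$, then $G$ is $k$-canceling.
   Context: If $H$ is a graph on $\{v_1,\dots,v_t\}$, its $(n_1,\dots,n_t)$-blowup is the graph on disjoint vertex sets $V_1,\dots,V_t$ with $|V_i|=n_i$ in which $u\in V_i$ and $w\in V_j$ are adjacent iff $v_iv_j\in E(H)$. A signing of a graph $G$ is a map $\sigma:E(G)\to\{\pm1\}$; for a path $P$, $\sigma(P)=\sum_{e\in P}\sigma(e)$. In a graph $H$, $d_\sigma(u,v)=\min_P|\sigma(P)|$ over all $uv$-paths $P$ in $H$ ($\infty$ if none, $0$ if $u=v$), and $W_\sigma(H)=\frac12\sum_{u,v\in V(H)}d_\sigma(u,v)$. $G$ is $k$-canceling if there is a signing $\sigma$ such that $W_\sigma(G-S)=0$ for every $S\subseteq V(G)$ with $|S|<k$ (with $\sigma$ restricted to $G-S$ and distances computed in $G-S$). -}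

module Defs where

open import Level using (0ℓ)
open import Data.Nat using (ℕ; zero; suc; _+_; _*_; _<_; _≤_; _%_)
open import Data.Fin using (Fin; toℕ)
open import Data.Integer as ℤ using (ℤ)
open import Data.Sign using (Sign)
import Data.Integer.Base as ℤB
open import Data.List using (List; []; _∷_; length)
open import Data.List.Membership.Propositional using (_∈_; _∉_)
open import Data.List.Relation.Unary.All using (All)
open import Data.List.Relation.Unary.Unique.Propositional using (Unique)
open import Data.Product using (Σ; Σ-syntax; ∃; ∃-syntax; _×_; _,_)
open import Data.Sum using (_⊎_)
open import Relation.Binary.PropositionalEquality using (_≡_)
open import Relation.Nullary using (¬_)

-- The cycle C_m on Fin m (m ≥ 3): i ~ j iff j ≡ i+1 (mod m) or i ≡ j+1 (mod m).
CycAdj : (m : ℕ) → .{{_ : Data.Nat.NonZero m}} → Fin m → Fin m → Set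
CycAdj m i j = (toℕ j ≡ suc (toℕ i) % m) ⊎ (toℕ i ≡ suc (toℕ j) % m)

-- The (n_1,…,n_{2t+1})-blowup of C_{2t+1}.  Vertex set: disjoint union of
-- V_i = Fin (n i); (i,a) ~ (j,b) iff i ~ j in the cycle.
OddCycleBlowupV : (t : ℕ) → (Fin (suc (t + t)) → ℕ) → Set
OddCycleBlowupV t n = Σ[ i ∈ Fin (suc (t + t)) ] Fin (n i)

OddCycleBlowupAdj : (t : ℕ) → (n : Fin (suc (t + t)) → ℕ) →
                    OddCycleBlowupV t n → OddCycleBlowupV t n → Set
OddCycleBlowupAdj t n (i , _) (j , _) = CycAdj (suc (t + t)) i j

------------------------------------------------------------------------
-- Signed graphs, paths, signed distance zero, k-canceling.
-- A graph is given by a vertex type V and a (symmetric) adjacency relation.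

module _ {V : Set} (Adj : V → V → Set) where

  -- A signing: a ±1 label for each (unordered) pair, used on edges;
  -- symmetric so that it is a function of the unordered edge.
  record Signing : Set where
    field
      sgn  : V → V → Sign
      sym  : ∀ u v → sgn u v ≡ sgn v u
  open Signing public

  -- Walks from u to v (a path is a walk with distinct vertices).
  data Walk : V → V → Set where
    nil  : ∀ {u} → Walk u u
    cons : ∀ {u w v} → Adj u w → Walk w v → Walk u v

  verts : ∀ {u v} → Walk u v → List V
  verts {u} nil        = u ∷ []
  verts {u} (cons _ p) = u ∷ verts p

  -- σ(P) = Σ_{e ∈ P} σ(e)
  sgnSum : Signing → ∀ {u v} → Walk u v → ℤ
  sgnSum σ nil                  = ℤ.0ℤ
  sgnSum σ (cons {u} {w} _ p) = (sgn σ u w ℤB.◃ 1) ℤ.+ sgnSum σ p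

  -- d_σ(u,v) = 0 in G - S: some uv-path P in G - S has |σ(P)| = 0.
  DistZero : Signing → List V → V → V → Set
  DistZero σ S u v = Σ[ P ∈ Walk u v ]
    (Unique (verts P) × All (_∉ S) (verts P) × sgnSum σ P ≡ ℤ.0ℤ)

  -- W_σ(G - S) = 0, i.e. (all d_σ ≥ 0, possibly ∞) every pair of vertices of
  -- G - S has signed distance 0 in G - S.
  WienerZero : Signing → List V → Set
  WienerZero σ S = ∀ u v → u ∉ S → v ∉ S → DistZero σ S u v

  -- G is k-canceling: some signing σ with W_σ(G - S) = 0 for all S, |S| < k.
  -- S is given as a list of vertices of length < k (duplicates only shrink
  -- the underlying set, so this ranges exactly over sets of size < k).
  KCanceling : ℕ → Set
  KCanceling k = Σ[ σ ∈ Signing ] (∀ (S : List V) → length S < k → WienerZero σ S)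

-- Charge a vertex of V_i positively if its index is below k and negatively otherwise, and
-- sign every edge between V_i and V_{i+1} by the charge of its endpoint in V_{i+1}.  Two
-- consecutive forward edges x → y → z then cancel as soon as y and z have opposite charges,
-- and removing fewer than k vertices leaves vertices of both charges in every part.  Of the
-- two arcs of the odd cycle between two distinct parts one has even length, so following it
-- forward in pairs of steps gives a zero-sum path through distinct parts.  Two vertices of the
-- same part are joined through the preceding part V_{i-1}: directly if their charges differ,
-- and via a vertex of V_i of the opposite charge otherwise.
module Submission where

open import Defs hiding (sym)
open import Data.Nat using (ℕ; zero; suc; _+_; _*_; _∸_; _%_; _≤_; _<_; _<?_; _≟_; s≤s; s≤s⁻¹; z<s; NonZero)
open import Data.Nat.Properties
open import Data.Nat.DivMod using (m%n<n; m<n⇒m%n≡m; m%n%n≡m%n; [m+n]%n≡m%n; %-distribˡ-+; m≤n⇒[n∸m]%m≡n%m)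
open import Data.Nat.Tactic.RingSolver using (solve-∀)
open import Data.Fin using (Fin; toℕ; fromℕ<; inject≤)
open import Data.Fin.Properties
  using (toℕ-injective; toℕ-fromℕ<; toℕ-inject≤; toℕ<n; injective⇒≤; ¬∀⟶∃¬)
  renaming (_≟_ to _≟ᶠ_)
open import Data.Sign as Sign using (Sign; opposite)
open import Data.Sign.Properties using (opposite-involutive; s≢opposite[s])
open import Data.Integer as ℤ using (0ℤ; _◃_)
import Data.Integer.Properties as ℤP
open import Data.Product using (Σ-syntax; ∃-syntax; _×_; _,_; proj₁)
open import Data.Product.Properties using (≡-dec)
open import Data.Sum using (_⊎_; inj₁; inj₂)
open import Data.Empty using (⊥; ⊥-elim)
open import Data.List using (List; []; _∷_; length; reverse; reverseAcc; drop)
open import Data.List.Membership.Propositional using (_∈_; _∉_)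
open import Data.List.Membership.DecPropositional using (_∈?_)
open import Data.List.Membership.Setoid.Properties using (index-injective)
open import Data.List.Relation.Unary.Any using (here)
open import Data.List.Relation.Unary.All as All using (All; []; _∷_)
open import Data.List.Relation.Unary.AllPairs using ([]; _∷_)
open import Data.List.Relation.Unary.Unique.Propositional using (Unique)
open import Data.List.Relation.Binary.Permutation.Propositional using (_↭_; ↭-sym; ↭⇒↭ₛ)
open import Data.List.Relation.Binary.Permutation.Propositional.Properties using (↭-reverse; All-resp-↭)
open import Data.List.Relation.Binary.Permutation.Setoid.Properties using (Unique-resp-↭)
open import Function using (_∘_)
open import Function.Definitions using (Injective)
open import Relation.Nullary using (¬_; yes; no)
open import Relation.Binary.Definitions using (DecidableEquality; tri<; tri≈; tri>)
open import Relation.Binary.PropositionalEquality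

injection-misses : ∀ {A : Set} → DecidableEquality A → ∀ {k} (f : Fin k → A) →
                   Injective _≡_ _≡_ f → (S : List A) → length S < k → ∃[ a ] f a ∉ S
injection-misses _≟A_ {k} f f-inj S |S|<k =
  ¬∀⟶∃¬ k (λ a → f a ∈ S) (λ a → _∈?_ _≟A_ (f a) S) all-in-S⇒k≤|S|
  where
    all-in-S⇒k≤|S| : ¬ (∀ a → f a ∈ S)
    all-in-S⇒k≤|S| f∈S =
      <⇒≱ |S|<k (injective⇒≤ λ {a} {b} eq → f-inj (index-injective (setoid _) (f∈S a) (f∈S b) eq))

◃1-opposite-cancel : ∀ s z → (s ◃ 1) ℤ.+ ((opposite s ◃ 1) ℤ.+ z) ≡ z
◃1-opposite-cancel s z =
  trans (sym (ℤP.+-assoc (s ◃ 1) (opposite s ◃ 1) z)) (trans (cong (ℤ._+ z) (cancel s)) (ℤP.+-identityˡ z))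
  where
    cancel : ∀ s → (s ◃ 1) ℤ.+ (opposite s ◃ 1) ≡ 0ℤ
    cancel Sign.+ = refl
    cancel Sign.- = refl

module _ {V : Set} {Adj : V → V → Set} where

  verts-head : ∀ {a b} (p : Walk Adj a b) → verts Adj p ≡ a ∷ drop 1 (verts Adj p)
  verts-head nil        = refl
  verts-head (cons _ p) = refl

  head∈verts : ∀ {a b} (p : Walk Adj a b) → a ∈ verts Adj p
  head∈verts nil        = here refl
  head∈verts (cons _ p) = here refl

module SignedWalks {V : Set} {Adj : V → V → Set} (Adj-sym : ∀ {u v} → Adj u v → Adj v u) (σ : Signing Adj) where

  reverseOnto : ∀ {a b c} → Walk Adj a b → Walk Adj a c → Walk Adj b c
  reverseOnto nil        acc = acc
  reverseOnto (cons e p) acc = reverseOnto p (cons (Adj-sym e) acc)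

  verts-reverseOnto : ∀ {a b c} (p : Walk Adj a b) (acc : Walk Adj a c) →
                      verts Adj (reverseOnto p acc) ≡ reverseAcc (verts Adj acc) (drop 1 (verts Adj p))
  verts-reverseOnto nil        acc = refl
  verts-reverseOnto (cons e p) acc =
    trans (verts-reverseOnto p (cons (Adj-sym e) acc))
          (cong (reverseAcc (verts Adj acc)) (sym (verts-head p)))

  sgnSum-reverseOnto : ∀ {a b c} (p : Walk Adj a b) (acc : Walk Adj a c) →
                       sgnSum Adj σ (reverseOnto p acc) ≡ sgnSum Adj σ p ℤ.+ sgnSum Adj σ acc
  sgnSum-reverseOnto nil acc = sym (ℤP.+-identityˡ _)
  sgnSum-reverseOnto (cons {a} {w} e p) acc = begin
    sgnSum Adj σ (reverseOnto p (cons (Adj-sym e) acc))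
      ≡⟨ sgnSum-reverseOnto p (cons (Adj-sym e) acc) ⟩
    Σp ℤ.+ ((sgn σ w a ◃ 1) ℤ.+ Σacc)
      ≡⟨ cong (λ s → Σp ℤ.+ ((s ◃ 1) ℤ.+ Σacc)) (Signing.sym σ w a) ⟩
    Σp ℤ.+ ((sgn σ a w ◃ 1) ℤ.+ Σacc)
      ≡⟨ sym (ℤP.+-assoc Σp _ Σacc) ⟩
    (Σp ℤ.+ (sgn σ a w ◃ 1)) ℤ.+ Σacc
      ≡⟨ cong (ℤ._+ Σacc) (ℤP.+-comm Σp _) ⟩
    ((sgn σ a w ◃ 1) ℤ.+ Σp) ℤ.+ Σacc
      ∎
    where
      open ≡-Reasoning
      Σp   = sgnSum Adj σ p
      Σacc = sgnSum Adj σ acc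

  reverseWalk : ∀ {a b} → Walk Adj a b → Walk Adj b a
  reverseWalk p = reverseOnto p nil

  verts-reverseWalk : ∀ {a b} (p : Walk Adj a b) → verts Adj (reverseWalk p) ≡ reverse (verts Adj p)
  verts-reverseWalk p = trans (verts-reverseOnto p nil) (cong reverse (sym (verts-head p)))

  DistZero-sym : ∀ S {u v} → DistZero Adj σ S u v → DistZero Adj σ S v u
  DistZero-sym S (P , unique , avoids , zero-sum) =
    reverseWalk P ,
    subst Unique (sym (verts-reverseWalk P)) (Unique-resp-↭ (setoid V) (↭⇒↭ₛ rev↭) unique) ,
    subst (All (_∉ S)) (sym (verts-reverseWalk P)) (All-resp-↭ rev↭ avoids) ,
    trans (sgnSum-reverseOnto P nil) (trans (ℤP.+-identityʳ _) zero-sum)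
    where
      rev↭ : verts Adj P ↭ reverse (verts Adj P)
      rev↭ = ↭-sym (↭-reverse (verts Adj P))

  sgnSum-cancel : ∀ {u w x y} (e : Adj u w) (e′ : Adj w x) (p : Walk Adj x y) →
                  sgn σ w x ≡ opposite (sgn σ u w) →
                  sgnSum Adj σ (cons e (cons e′ p)) ≡ sgnSum Adj σ p
  sgnSum-cancel {u} {w} e e′ p opp =
    trans (cong (λ s → (sgn σ u w ◃ 1) ℤ.+ ((s ◃ 1) ℤ.+ sgnSum Adj σ p)) opp)
          (◃1-opposite-cancel (sgn σ u w) (sgnSum Adj σ p))

[1+m%n]%n≡[1+m]%n : ∀ m n .{{_ : NonZero n}} → suc (m % n) % n ≡ suc m % n
[1+m%n]%n≡[1+m]%n m n = begin
  suc (m % n) % n          ≡⟨ %-distribˡ-+ 1 (m % n) n ⟩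
  (1 % n + m % n % n) % n  ≡⟨ cong (λ r → (1 % n + r) % n) (m%n%n≡m%n m n) ⟩
  (1 % n + m % n) % n      ≡⟨ %-distribˡ-+ 1 m n ⟨
  suc m % n                ∎
  where open ≡-Reasoning

[m+d]%n≢m : ∀ {m d} n .{{_ : NonZero n}} → m < n → 0 < d → d < n → (m + d) % n ≢ m
[m+d]%n≢m {m} {d} n m<n 0<d d<n with m + d <? n
... | yes m+d<n = λ eq → <⇒≢ (m<m+n m 0<d) (sym (trans (sym (m<n⇒m%n≡m m+d<n)) eq))
... | no m+d≮n = λ eq → <⇒≢ d<n (+-cancelˡ-≡ m d n (trans (sym (m∸n+n≡m n≤m+d)) (wrapped eq)))
  where
    n≤m+d : n ≤ m + d
    n≤m+d = ≮⇒≥ m+d≮n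
    reduced : (m + d ∸ n) % n ≡ m + d ∸ n
    reduced = m<n⇒m%n≡m (+-cancelʳ-< n _ n (subst (_< n + n) (sym (m∸n+n≡m n≤m+d)) (+-mono-< m<n d<n)))
    wrapped : (m + d) % n ≡ m → m + d ∸ n + n ≡ m + n
    wrapped eq = cong (_+ n) (trans (sym reduced) (trans (m≤n⇒[n∸m]%m≡n%m n≤m+d) eq))

%-injective-window : ∀ {c e} n .{{_ : NonZero n}} → c < e → e < c + n → c % n ≢ e % n
%-injective-window {c} {e} n c<e e<c+n c≡e = [m+d]%n≢m n (m%n<n c n) (m<n⇒0<n∸m c<e) d<n (begin
  (c % n + d) % n      ≡⟨ cong (λ r → (c % n + r) % n) (m<n⇒m%n≡m d<n) ⟨
  (c % n + d % n) % n  ≡⟨ %-distribˡ-+ c d n ⟨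
  (c + d) % n          ≡⟨ cong (_% n) (m+[n∸m]≡n (<⇒≤ c<e)) ⟩
  e % n                ≡⟨ c≡e ⟨
  c % n                ∎)
  where
    open ≡-Reasoning
    d : ℕ
    d = e ∸ c
    d<n : d < n
    d<n = +-cancelˡ-< c d n (subst (_< c + n) (sym (m+[n∸m]≡n (<⇒≤ c<e))) e<c+n)

even-or-odd : ∀ m → (∃[ h ] m ≡ h + h) ⊎ (∃[ h ] m ≡ suc (h + h))
even-or-odd zero = inj₁ (0 , refl)
even-or-odd (suc m) with even-or-odd m
... | inj₁ (h , m≡h+h) = inj₂ (h , cong suc m≡h+h)
... | inj₂ (h , m≡1+h+h) = inj₁ (suc h , trans (cong suc m≡1+h+h) (cong suc (sym (+-suc h h))))

≢⇒≡opposite : ∀ {s s′} → s ≢ s′ → s′ ≡ opposite s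
≢⇒≡opposite {Sign.+} {Sign.+} s≢s′ = ⊥-elim (s≢s′ refl)
≢⇒≡opposite {Sign.+} {Sign.-} _    = refl
≢⇒≡opposite {Sign.-} {Sign.+} _    = refl
≢⇒≡opposite {Sign.-} {Sign.-} s≢s′ = ⊥-elim (s≢s′ refl)

double-shift : ∀ r c → suc (suc r) + suc (suc r) + c ≡ suc r + suc r + suc (suc c)
double-shift = solve-∀

odd-gap-wrap : ∀ h r p → p + suc ((suc h + r) + (suc h + r)) ≡ suc r + suc r + (suc (h + h) + p)
odd-gap-wrap = solve-∀

module Blowup (t : ℕ) (1≤t : 1 ≤ t) (k : ℕ) (n : Fin (suc (t + t)) → ℕ) (2k≤n : ∀ i → 2 * k ≤ n i) where

  M : ℕ
  M = suc (t + t)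

  V : Set
  V = OddCycleBlowupV t n

  Adj : V → V → Set
  Adj = OddCycleBlowupAdj t n

  Adj-sym : ∀ {u v} → Adj u v → Adj v u
  Adj-sym (inj₁ fwd) = inj₂ fwd
  Adj-sym (inj₂ bwd) = inj₁ bwd

  part : V → ℕ
  part (i , _) = toℕ i

  -- Positions c range over ℕ and are read modulo M, so walks can advance without wrapping.
  infix 4 _at_
  record _at_ (x : V) (c : ℕ) : Set where
    constructor placed
    field part≡ : part x ≡ c % M

  part≡part%M : ∀ x → part x ≡ part x % M
  part≡part%M (i , _) = sym (m<n⇒m%n≡m (toℕ<n i))

  at-part : ∀ x → x at part x
  at-part x = placed (part≡part%M x)

  at-wrap : ∀ {x c} → x at c → x at suc (c + (t + t))
  at-wrap {x} {c} (placed xc) = placed (trans xc (trans (sym ([m+n]%n≡m%n c M)) (cong (_% M) (+-suc c (t + t)))))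

  at-distinct : ∀ {c e x y} → x at c → y at e → c < e → e < c + M → x ≢ y
  at-distinct (placed xc) (placed ye) c<e e<c+M refl = %-injective-window M c<e e<c+M (trans (sym xc) ye)

  at-wrap-distinct : ∀ {c x w} → x at c → w at c + (t + t) → x ≢ w
  at-wrap-distinct {c} xc wc =
    at-distinct xc wc (m<m+n c (≤-trans 1≤t (m≤m+n t t))) (+-monoʳ-< c (n<1+n (t + t)))

  Forward : V → V → Set
  Forward x y = part y ≡ suc (part x) % M

  forward : ∀ {c x y} → x at c → y at suc c → Forward x y
  forward {c} (placed xc) (placed yc) = trans yc (sym (trans (cong (λ r → suc r % M) xc) ([1+m%n]%n≡[1+m]%n c M)))

  forward-asym : ∀ {x y} → Forward x y → Forward y x → ⊥
  forward-asym {x} x→y y→x =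
    %-injective-window M (m<n+m (part x) z<s) 2+x<x+M (trans (sym (part≡part%M x)) x-at-2+x)
    where
      x-at-2+x : part x ≡ suc (suc (part x)) % M
      x-at-2+x = trans y→x (trans (cong (λ r → suc r % M) x→y) ([1+m%n]%n≡[1+m]%n (suc (part x)) M))
      2+x<x+M : suc (suc (part x)) < part x + M
      2+x<x+M = subst (suc (suc (part x)) <_) (+-comm M (part x)) (+-monoˡ-≤ (part x) (s≤s (+-mono-≤ 1≤t 1≤t)))

  chargeOf : ℕ → Sign
  chargeOf m with m <? k
  ... | yes _ = Sign.+
  ... | no _  = Sign.-

  chargeOf-< : ∀ {m} → m < k → chargeOf m ≡ Sign.+
  chargeOf-< {m} m<k with m <? k
  ... | yes _   = refl
  ... | no m≮k  = ⊥-elim (m≮k m<k)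

  chargeOf-≥ : ∀ {m} → k ≤ m → chargeOf m ≡ Sign.-
  chargeOf-≥ {m} k≤m with m <? k
  ... | yes m<k = ⊥-elim (<⇒≱ m<k k≤m)
  ... | no _    = refl

  index : V → ℕ
  index (_ , a) = toℕ a

  charge : V → Sign
  charge v = chargeOf (index v)

  index-distinct : ∀ {i} {a b : Fin (n i)} → a ≢ b → (i , a) ≢ (i , b)
  index-distinct a≢b = a≢b ∘ toℕ-injective ∘ cong index

  edgeSign : V → V → Sign
  edgeSign x y with part y ≟ suc (part x) % M | part x ≟ suc (part y) % M
  ... | yes _ | _     = charge y
  ... | no _  | yes _ = charge x
  ... | no _  | no _  = Sign.+

  edgeSign-sym : ∀ x y → edgeSign x y ≡ edgeSign y x
  edgeSign-sym x y with part y ≟ suc (part x) % M | part x ≟ suc (part y) % M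
  ... | yes x→y | yes y→x = ⊥-elim (forward-asym {x} {y} x→y y→x)
  ... | yes _   | no _    = refl
  ... | no _    | yes _   = refl
  ... | no _    | no _    = refl

  σ : Signing Adj
  σ = record { sgn = edgeSign ; sym = edgeSign-sym }

  open SignedWalks (λ {u} {v} → Adj-sym {u} {v}) σ using (DistZero-sym; sgnSum-cancel)

  edgeSign-forward : ∀ {x y} → Forward x y → edgeSign x y ≡ charge y
  edgeSign-forward {x} {y} x→y with part y ≟ suc (part x) % M
  ... | yes _   = refl
  ... | no ¬x→y = ⊥-elim (¬x→y x→y)

  edgeSign-backward : ∀ {x y} → Forward y x → edgeSign x y ≡ charge x
  edgeSign-backward {x} {y} y→x = trans (edgeSign-sym x y) (edgeSign-forward y→x)

  charge-distinct : ∀ {x y} → charge x ≢ charge y → x ≢ y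
  charge-distinct ≢charge x≡y = ≢charge (cong charge x≡y)

  via-predecessor : ∀ {c u w v y} → w at c + (t + t) → u at c → v at c → Walk Adj v y → Walk Adj u y
  via-predecessor {w = w} wc uc vc p =
    cons (inj₂ (forward wc (at-wrap uc))) (cons {u = w} (inj₁ (forward wc (at-wrap vc))) p)

  sgnSum-via-predecessor : ∀ {c u w v y} (wc : w at c + (t + t)) (uc : u at c) (vc : v at c) (p : Walk Adj v y) →
                           charge v ≡ opposite (charge u) →
                           sgnSum Adj σ (via-predecessor wc uc vc p) ≡ sgnSum Adj σ p
  sgnSum-via-predecessor {u = u} {w} {v} wc uc vc p opp = sgnSum-cancel (inj₂ w→u) (inj₁ w→v) p cancels
    where
      w→u : Forward w u
      w→u = forward wc (at-wrap uc)
      w→v : Forward w v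
      w→v = forward wc (at-wrap vc)
      cancels : edgeSign w v ≡ opposite (edgeSign u w)
      cancels = trans (edgeSign-forward w→v) (trans opp (cong opposite (sym (edgeSign-backward w→u))))

  k+a<n : ∀ i (a : Fin k) → k + toℕ a < n i
  k+a<n i a = <-≤-trans (+-monoʳ-< k (toℕ<n a)) (subst (_≤ n i) (cong (k +_) (+-identityʳ k)) (2k≤n i))

  k≤n : ∀ i → k ≤ n i
  k≤n i = ≤-trans (m≤m+n k (k + 0)) (2k≤n i)

  slot : ∀ i → Sign → Fin k → Fin (n i)
  slot i Sign.+ a = inject≤ a (k≤n i)
  slot i Sign.- a = fromℕ< (k+a<n i a)

  charge-slot : ∀ i s a → charge (i , slot i s a) ≡ s
  charge-slot i Sign.+ a = trans (cong chargeOf (toℕ-inject≤ a (k≤n i))) (chargeOf-< (toℕ<n a))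
  charge-slot i Sign.- a = trans (cong chargeOf (toℕ-fromℕ< (k+a<n i a))) (chargeOf-≥ (m≤m+n k (toℕ a)))

  slot-injective : ∀ i s → Injective _≡_ _≡_ (λ a → (i , slot i s a))
  slot-injective i s eq = toℕ-injective (toℕ-slot-injective s (cong index eq))
    where
      toℕ-slot-injective : ∀ s {a b} → toℕ (slot i s a) ≡ toℕ (slot i s b) → toℕ a ≡ toℕ b
      toℕ-slot-injective Sign.+ {a} {b} eq =
        trans (sym (toℕ-inject≤ a (k≤n i))) (trans eq (toℕ-inject≤ b (k≤n i)))
      toℕ-slot-injective Sign.- {a} {b} eq =
        +-cancelˡ-≡ k _ _ (trans (sym (toℕ-fromℕ< (k+a<n i a))) (trans eq (toℕ-fromℕ< (k+a<n i b))))

  _≟ᵛ_ : DecidableEquality V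
  _≟ᵛ_ = ≡-dec _≟ᶠ_ _≟ᶠ_

  module _ (S : List V) (|S|<k : length S < k) where

    survivor : ∀ i s → ∃[ a ] charge (i , a) ≡ s × (i , a) ∉ S
    survivor i s with injection-misses _≟ᵛ_ (λ a → (i , slot i s a)) (slot-injective i s) S |S|<k
    ... | a , ∉S = slot i s a , charge-slot i s a , ∉S

    pick : ∀ c s → ∃[ y ] y at c × charge y ≡ s × y ∉ S
    pick c s with survivor (fromℕ< (m%n<n c M)) s
    ... | a , charge≡s , ∉S = (_ , a) , placed (toℕ-fromℕ< (m%n<n c M)) , charge≡s , ∉S

    InArc : ℕ → ℕ → V → Set
    InArc c d w = ∃[ e ] c ≤ e × e ≤ d × w at e

    -- Confining the positions to a window [c, d] with d < c + M is what keeps prepended walks paths.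
    ArcWalk : V → V → ℕ → ℕ → Set
    ArcWalk x v c d = Σ[ P ∈ Walk Adj x v ]
      (Unique (verts Adj P) × All (_∉ S) (verts Adj P) × sgnSum Adj σ P ≡ 0ℤ) × All (InArc c d) (verts Adj P)

    arc-nil : ∀ {c v} → v at c → v ∉ S → ArcWalk v v c c
    arc-nil {c} vc v∉S = nil , ([] ∷ [] , v∉S ∷ [] , refl) , (c , ≤-refl , ≤-refl , vc) ∷ []

    prepend-pair : ∀ {c d x z v} → d < c + M → x at c → z at suc (suc c) → x ∉ S →
                   ArcWalk z v (suc (suc c)) d → ArcWalk x v c d
    prepend-pair {c} {d} {x} {z} d<c+M xc zc x∉S (P , (unique , avoids , zero-sum) , arc)
      with pick (suc c) (opposite (charge z))
    ... | y , yc , charge-y , y∉S =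
      cons x─y (cons y─z P) ,
      ( (x≢y ∷ All.map x-fresh arc) ∷ All.map y-fresh arc ∷ unique
      , x∉S ∷ y∉S ∷ avoids
      , trans (sgnSum-cancel x─y y─z P cancels) zero-sum ) ,
      (c , ≤-refl , ≤-trans (n≤1+n c) (≤-trans (n≤1+n _) 2+c≤d) , xc) ∷
      (suc c , n≤1+n c , ≤-trans (n≤1+n _) 2+c≤d , yc) ∷ All.map widen arc
      where
        x→y : Forward x y
        x→y = forward xc yc
        y→z : Forward y z
        y→z = forward yc zc
        x─y : Adj x y
        x─y = inj₁ x→y
        y─z : Adj y z
        y─z = inj₁ y→z
        cancels : edgeSign y z ≡ opposite (edgeSign x y)
        cancels = begin
          edgeSign y z                    ≡⟨ edgeSign-forward y→z ⟩
          charge z                        ≡⟨ opposite-involutive (charge z) ⟨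
          opposite (opposite (charge z))  ≡⟨ cong opposite charge-y ⟨
          opposite (charge y)             ≡⟨ cong opposite (edgeSign-forward x→y) ⟨
          opposite (edgeSign x y)         ∎
          where open ≡-Reasoning
        2+c≤d : suc (suc c) ≤ d
        2+c≤d with All.lookup arc (head∈verts P)
        ... | _ , 2+c≤e , e≤d , _ = ≤-trans 2+c≤e e≤d
        x≢y : x ≢ y
        x≢y = at-distinct xc yc (n<1+n c) (<-trans 2+c≤d d<c+M)
        x-fresh : ∀ {w} → InArc (suc (suc c)) d w → x ≢ w
        x-fresh (e , 2+c≤e , e≤d , we) = at-distinct xc we (≤-trans (n≤1+n _) 2+c≤e) (≤-<-trans e≤d d<c+M)
        y-fresh : ∀ {w} → InArc (suc (suc c)) d w → y ≢ w
        y-fresh (e , 2+c≤e , e≤d , we) = at-distinct yc we 2+c≤e (≤-<-trans e≤d (m<n⇒m<1+n d<c+M))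
        widen : ∀ {w} → InArc (suc (suc c)) d w → InArc c d w
        widen (e , 2+c≤e , e≤d , we) = e , ≤-trans (n≤1+n c) (≤-trans (n≤1+n _) 2+c≤e) , e≤d , we

    forget-arc : ∀ {x v c d} → ArcWalk x v c d → DistZero Adj σ S x v
    forget-arc (P , dist-zero , _) = P , dist-zero

    forward-walk : ∀ r {c d x v} → d ≡ suc r + suc r + c → d < c + M →
                   x at c → v at d → x ∉ S → v ∉ S → ArcWalk x v c d
    forward-walk zero    refl d<c+M xc vd x∉S v∉S = prepend-pair d<c+M xc vd x∉S (arc-nil vd v∉S)
    forward-walk (suc r) {c} {d} d≡ d<c+M xc vd x∉S v∉S with pick (suc (suc c)) Sign.+
    ... | z , zc , _ , z∉S =
      prepend-pair d<c+M xc zc x∉S (forward-walk r (trans d≡ (double-shift r c)) d<2+c+M zc vd z∉S v∉S)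
      where
        d<2+c+M : d < suc (suc c) + M
        d<2+c+M = <-≤-trans d<c+M (+-monoˡ-≤ M (≤-trans (n≤1+n c) (n≤1+n _)))

    even-gap : ∀ r u v → part v ≡ suc r + suc r + part u → u ∉ S → v ∉ S → DistZero Adj σ S u v
    even-gap r u v q≡ u∉S v∉S =
      forget-arc (forward-walk r q≡ q<p+M (at-part u) (at-part v) u∉S v∉S)
      where
        q<p+M : part v < part u + M
        q<p+M = <-≤-trans (toℕ<n (proj₁ v)) (m≤n+m M (part u))

    -- The even arc runs forward from v to u, which sits at position part u + M.
    odd-gap : ∀ h u v → part v ≡ suc (h + h) + part u → u ∉ S → v ∉ S → DistZero Adj σ S v u
    odd-gap h u v q≡ u∉S v∉S with m≤n⇒∃[o]m+o≡n h<t
      where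
        h<t : h < t
        2h+1<M : suc (h + h) < M
        2h+1<M = ≤-<-trans (m≤m+n _ (part u)) (subst (_< M) q≡ (toℕ<n (proj₁ v)))
        h<t = ≰⇒> λ t≤h → <⇒≱ (s≤s⁻¹ 2h+1<M) (+-mono-≤ t≤h t≤h)
    ... | r , 1+h+r≡t =
      forget-arc (forward-walk r p+M≡ (+-monoˡ-< M p<q) (at-part v) u-at-p+M v∉S u∉S)
      where
        p+M≡ : part u + M ≡ suc r + suc r + part v
        p+M≡ = begin
          part u + suc (t + t)                      ≡⟨ cong (λ s → part u + suc (s + s)) 1+h+r≡t ⟨
          part u + suc ((suc h + r) + (suc h + r))  ≡⟨ odd-gap-wrap h r (part u) ⟩
          suc r + suc r + (suc (h + h) + part u)    ≡⟨ cong (suc r + suc r +_) q≡ ⟨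
          suc r + suc r + part v                    ∎
          where open ≡-Reasoning
        p<q : part u < part v
        p<q = subst (part u <_) (sym q≡) (m<n+m (part u) z<s)
        u-at-p+M : u at part u + M
        u-at-p+M = placed (trans (part≡part%M u) (sym ([m+n]%n≡m%n (part u) M)))

    distinct-parts : ∀ u v → part u < part v → u ∉ S → v ∉ S → DistZero Adj σ S u v
    distinct-parts u v p<q u∉S v∉S with even-or-odd (part v ∸ part u) | sym (m∸n+n≡m (<⇒≤ p<q))
    ... | inj₁ (zero , q∸p≡0)     | _  = ⊥-elim (<-irrefl (sym q∸p≡0) (m<n⇒0<n∸m p<q))
    ... | inj₁ (suc r , q∸p≡2r+2) | q≡ = even-gap r u v (trans q≡ (cong (_+ part u) q∸p≡2r+2)) u∉S v∉S
    ... | inj₂ (h , q∸p≡2h+1)     | q≡ =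
      DistZero-sym S (odd-gap h u v (trans q≡ (cong (_+ part u) q∸p≡2h+1)) u∉S v∉S)

    same-part-opposite-charges : ∀ i {a b} → let u = (i , a) ; v = (i , b) in
      u ≢ v → charge v ≡ opposite (charge u) → u ∉ S → v ∉ S → DistZero Adj σ S u v
    same-part-opposite-charges i {a} {b} u≢v opp u∉S v∉S with pick (toℕ i + (t + t)) Sign.+
    ... | w , wc , _ , w∉S =
      via-predecessor wc uc vc nil ,
      (at-wrap-distinct uc wc ∷ u≢v ∷ []) ∷ (≢-sym (at-wrap-distinct vc wc) ∷ []) ∷ [] ∷ [] ,
      u∉S ∷ w∉S ∷ v∉S ∷ [] ,
      sgnSum-via-predecessor wc uc vc nil opp
      where
        uc : (i , a) at toℕ i
        uc = at-part (i , a)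
        vc : (i , b) at toℕ i
        vc = at-part (i , b)

    same-part-equal-charges : ∀ i {a b} → let u = (i , a) ; v = (i , b) in
      u ≢ v → charge u ≡ charge v → u ∉ S → v ∉ S → DistZero Adj σ S u v
    same-part-equal-charges i {a} {b} u≢v u≈v u∉S v∉S
      with pick (toℕ i + (t + t)) Sign.+ | pick (toℕ i + (t + t)) Sign.- | pick (toℕ i) (opposite (charge (i , a)))
    ... | w₊ , w₊c , charge-w₊ , w₊∉S | w₋ , w₋c , charge-w₋ , w₋∉S | x , xc , charge-x , x∉S =
      via-predecessor w₊c uc xc (via-predecessor w₋c xc vc nil) ,
      (at-wrap-distinct uc w₊c ∷ u≢x ∷ at-wrap-distinct uc w₋c ∷ u≢v ∷ []) ∷
      (≢-sym (at-wrap-distinct xc w₊c) ∷ w₊≢w₋ ∷ ≢-sym (at-wrap-distinct vc w₊c) ∷ []) ∷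
      (at-wrap-distinct xc w₋c ∷ x≢v ∷ []) ∷
      (≢-sym (at-wrap-distinct vc w₋c) ∷ []) ∷ [] ∷ [] ,
      u∉S ∷ w₊∉S ∷ x∉S ∷ w₋∉S ∷ v∉S ∷ [] ,
      trans (sgnSum-via-predecessor w₊c uc xc (via-predecessor w₋c xc vc nil) charge-x)
            (sgnSum-via-predecessor w₋c xc vc nil v-opposite-x)
      where
        u v : V
        u = (i , a)
        v = (i , b)
        uc : u at toℕ i
        uc = at-part u
        vc : v at toℕ i
        vc = at-part v
        u≢x : u ≢ x
        u≢x = charge-distinct λ eq → s≢opposite[s] (charge u) (trans eq charge-x)
        x≢v : x ≢ v
        x≢v = ≢-sym (charge-distinct λ eq → s≢opposite[s] (charge u) (trans u≈v (trans eq charge-x)))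
        w₊≢w₋ : w₊ ≢ w₋
        w₊≢w₋ = charge-distinct λ eq → s≢opposite[s] Sign.+ (trans (sym charge-w₊) (trans eq charge-w₋))
        v-opposite-x : charge v ≡ opposite (charge x)
        v-opposite-x = trans (sym u≈v) (trans (sym (opposite-involutive (charge u))) (cong opposite (sym charge-x)))

    same-part : ∀ i a b → (i , a) ∉ S → (i , b) ∉ S → DistZero Adj σ S (i , a) (i , b)
    same-part i a b u∉S v∉S with a ≟ᶠ b | charge (i , a) Sign.≟ charge (i , b)
    ... | yes refl | _       = nil , [] ∷ [] , u∉S ∷ [] , refl
    ... | no a≢b   | yes u≈v = same-part-equal-charges i (index-distinct a≢b) u≈v u∉S v∉S
    ... | no a≢b   | no u≉v  = same-part-opposite-charges i (index-distinct a≢b) (≢⇒≡opposite u≉v) u∉S v∉S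

    wiener-zero : WienerZero Adj σ S
    wiener-zero (i , a) (j , b) u∉S v∉S with <-cmp (toℕ i) (toℕ j)
    ... | tri< i<j _ _ = distinct-parts _ _ i<j u∉S v∉S
    ... | tri> _ _ j<i = DistZero-sym S (distinct-parts _ _ j<i v∉S u∉S)
    ... | tri≈ _ i≡j _ with toℕ-injective i≡j
    ... | refl = same-part i a b u∉S v∉S

proposition4p3 : (t k : ℕ) → 1 ≤ t → 1 ≤ k →
    (n : Fin (suc (t + t)) → ℕ) → (∀ i → 2 * k ≤ n i) →
    KCanceling (OddCycleBlowupAdj t n) k
proposition4p3 t k 1≤t _ n 2k≤n = σ , wiener-zero
  where open Blowup t 1≤t k n 2k≤n
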